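{- Let $B=\{201\}$, and let $A(x,v)$ and $B(x,v,u)$ be the generating functions defined in the context. The generating function $\sum_{n\geq 0}|I_n(201)|\,x^{n+1}$ is equal to $A(x,0)$, and it satisfies $$A(x,0)=\frac{x}{1-2x}+2x^2\,B(x,2x,1).$$
   Context: For $n\ge 0$, $I_n$ denotes the set of inversion sequences $e=e_0e_1\cdots e_n$, i.e. integer sequences with $0\le e_i\le i$ for each $0\le i\le n$. An inversion sequence contains a pattern $\tau$ if it has a (not necessarily consecutive) subsequence order isomorphic to $\tau$ (including equalities); otherwise it avoids $\tau$. $I_n(\tau)$ is the set of $e\in I_n$ avoiding $\tau$, and $I_n(B)$ the set of those avoiding all patterns in $B$. $\mathcal T(B)$ is the rooted plane tree with root $0$ whose level-$n$ nodes are the elements of $I_n(B)$ (root at level 0), where the parent of $e_0\cdots e_n$ is $e_0\cdots e_{n-1}$ and siblings are ordered left to right by increasing last letter. For a node $e$, $\mathcal T(B;e)$ is the subtree consisting of $e$ and its descendants. The generating function for the number of nodes in $\mathcal T(B;e)$ is the power series in which a node at distance $\ell\ge 0$ below the root $e$ contributes $x^{\ell+1}$. Here $0^m$ is the word of $m$ zeros and $0^mj$ is $0^m$ followed by the letter $j$. Let $A_m(x)$ (for $m\ge1$) and $B_{m,j}(x)$ (for $2\le j\le m$) be the generating functions for the number of nodes in $\mathcal T(B;0^m)$ and $\mathcal T(B;0^mj)$ respectively, and set $$A(x,v)=\sum_{m\ge1}A_m(x)v^{m-1},\qquad B(x,v,u)=\sum_{m\ge2}\sum_{j=2}^m B_{m,j}(x)\,v^{m-2}u^{m-j}.$$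 -}

module Defs where

open import Data.Fin.Base using (Fin; zero; suc; toℕ; fromℕ; inject₁)
open import Data.Fin.Properties using (all?; toℕ-inject₁; toℕ-fromℕ)
open import Data.Fin.Relation.Unary.Top using (view; ‵fromℕ; ‵inject₁)
open import Data.Integer.Base as ℤ using (ℤ; +_)
import Data.Integer.Properties as ℤ
open import Data.List.Base as List using (List; []; _∷_)
open import Data.List.Membership.Propositional using (_∈_)
open import Data.List.Membership.Propositional.Properties
  using (∈-cartesianProductWith⁺; ∈-cartesianProductWith⁻; ∈-upTo⁺; ∈-upTo⁻;
         ∈-filter⁺; ∈-filter⁻)
open import Data.List.Relation.Binary.Sublist.Propositional as Sub using (_⊆_)
open import Data.List.Relation.Unary.All as All using (All; [])
open import Data.List.Relation.Unary.AllPairs using ([]; _∷_)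
open import Data.List.Relation.Unary.Any using (here)
open import Data.List.Relation.Unary.Unique.Propositional using (Unique)
import Data.List.Relation.Unary.Unique.Propositional.Properties as Unique
open import Data.Nat.Base as ℕ using (ℕ; zero; suc; _≤_; _<_; s≤s; _∸_)
import Data.Nat.Properties as ℕ
open import Data.Product.Base using (∃; _×_; _,_)
open import Data.Sum.Base using (inj₁; inj₂; [_,_]′)
open import Data.Vec.Base as Vec using (Vec; []; _∷_; _∷ʳ_; lookup; toList; init)
import Data.Vec.Properties as Vec
open import Function.Base using (_∘_)
open import Function.Bundles using (_⇔_; mk⇔; Equivalence)
open import Relation.Binary.PropositionalEquality
  using (_≡_; refl; sym; trans; cong; subst₂; module ≡-Reasoning)
open import Relation.Nullary using (¬_; Dec; no)
open import Relation.Nullary.Decidable using (map′; _×-dec_; _⊎-dec_; _→-dec_; ¬?)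
open import Relation.Unary using (Pred; Decidable)
open import Level using (0ℓ)

open import Algebra.Properties.Semiring.Sum ℤ.+-*-semiring
  using (sum; sum-syntax; sum⁺-syntax; sum-cong-≗; sum-replicate-zero)

record Finite {A : Set} (P : Pred A 0ℓ) : Set where
  field
    elements : List A
    unique   : Unique elements
    sound    : ∀ {x} → x ∈ elements → P x
    complete : ∀ {x} → P x → x ∈ elements

  card : ℕ
  card = List.length elements

open Finite public using (card)

restrict : ∀ {A : Set} {P Q : Pred A 0ℓ} →
           Finite P → Decidable Q → Finite (λ x → P x × Q x)
restrict fin Q? = record
  { elements = List.filter Q? elements
  ; unique   = Unique.filter⁺ Q? unique
  ; sound    = λ p → let q , r = ∈-filter⁻ Q? p in sound q , r
  ; complete = λ (p , q) → ∈-filter⁺ Q? (complete p) q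
  } where open Finite fin

Pattern : Set
Pattern = ∃ (Vec ℕ)

OrderIsomorphic : ∀ {p} → Vec ℕ p → Vec ℕ p → Set
OrderIsomorphic s t = ∀ i j →
  (lookup s i < lookup s j ⇔ lookup t i < lookup t j) ×
  (lookup s i ≡ lookup s j ⇔ lookup t i ≡ lookup t j)

Contains : ∀ {k} → Vec ℕ k → Pattern → Set
Contains e (_ , τ) = ∃ λ s → toList s ⊆ toList e × OrderIsomorphic s τ

Avoids : ∀ {k} → Vec ℕ k → List Pattern → Set
Avoids e B = All (λ τ → ¬ Contains e τ) B

_⇔?_ : ∀ {P Q : Set} → Dec P → Dec Q → Dec (P ⇔ Q)
P? ⇔? Q? = map′ (λ (f , g) → mk⇔ f g) (λ h → Equivalence.to h , Equivalence.from h)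
                ((P? →-dec Q?) ×-dec (Q? →-dec P?))

orderIsomorphic? : ∀ {p} (s t : Vec ℕ p) → Dec (OrderIsomorphic s t)
orderIsomorphic? s t = all? λ i → all? λ j →
  ((lookup s i ℕ.<? lookup s j) ⇔? (lookup t i ℕ.<? lookup t j)) ×-dec
  ((lookup s i ℕ.≟ lookup s j) ⇔? (lookup t i ℕ.≟ lookup t j))

anySublist? : ∀ {p} {P : Pred (Vec ℕ p) 0ℓ} → Decidable P →
              ∀ xs → Dec (∃ λ s → toList s ⊆ xs × P s)
anySublist? {zero} P? xs =
  map′ (λ p → [] , Sub.minimum xs , p) (λ { ([] , _ , p) → p }) (P? [])
anySublist? {suc p} P? [] = no λ { (_ ∷ _ , () , _) }
anySublist? {suc p} P? (x ∷ xs) =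
  map′ [ (λ (s , s⊆ , q) → s , (x Sub.∷ʳ s⊆) , q)
       , (λ (s , s⊆ , q) → x ∷ s , (refl Sub.∷ s⊆) , q) ]′
       (λ { (y ∷ s , (_ Sub.∷ʳ s⊆) , q) → inj₁ (y ∷ s , s⊆ , q)
          ; (_ ∷ s , (refl Sub.∷ s⊆) , q) → inj₂ (s , s⊆ , q) })
       (anySublist? P? xs ⊎-dec anySublist? (P? ∘ (x ∷_)) xs)

contains? : ∀ {k} (e : Vec ℕ k) → Decidable (Contains e)
contains? e (_ , τ) = anySublist? (λ s → orderIsomorphic? s τ) (toList e)

avoids? : ∀ {k} (B : List Pattern) → Decidable (λ (e : Vec ℕ k) → Avoids e B)
avoids? B e = All.all? (λ τ → ¬? (contains? e τ)) B

-- Inversion sequences.  I_n consists of words e₀ ⋯ eₙ, of length n + 1.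

InversionSequence : ∀ {k} → Vec ℕ k → Set
InversionSequence e = ∀ i → lookup e i ≤ toℕ i

module _ {A : Set} where

  lookup-∷ʳ-inject₁ : ∀ {k} (xs : Vec A k) x i →
                      lookup (xs ∷ʳ x) (inject₁ i) ≡ lookup xs i
  lookup-∷ʳ-inject₁ (_ ∷ _)  x zero    = refl
  lookup-∷ʳ-inject₁ (_ ∷ xs) x (suc i) = lookup-∷ʳ-inject₁ xs x i

  lookup-∷ʳ-fromℕ : ∀ {k} (xs : Vec A k) x → lookup (xs ∷ʳ x) (fromℕ k) ≡ x
  lookup-∷ʳ-fromℕ []       x = refl
  lookup-∷ʳ-fromℕ (_ ∷ xs) x = lookup-∷ʳ-fromℕ xs x

inversionSequence-∷ʳ⁺ : ∀ {k} (xs : Vec ℕ k) {x} →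
  InversionSequence xs → x ≤ k → InversionSequence (xs ∷ʳ x)
inversionSequence-∷ʳ⁺ {k} xs {x} inv x≤k i with view i
... | ‵fromℕ     = subst₂ _≤_ (sym (lookup-∷ʳ-fromℕ xs x)) (sym (toℕ-fromℕ k)) x≤k
... | ‵inject₁ j = subst₂ _≤_ (sym (lookup-∷ʳ-inject₁ xs x j)) (sym (toℕ-inject₁ j)) (inv j)

inversionSequence-∷ʳ⁻ : ∀ {k} (xs : Vec ℕ k) {x} →
  InversionSequence (xs ∷ʳ x) → InversionSequence xs × x ≤ k
inversionSequence-∷ʳ⁻ {k} xs {x} inv =
  (λ i → subst₂ _≤_ (lookup-∷ʳ-inject₁ xs x i) (toℕ-inject₁ i) (inv (inject₁ i))) ,
  subst₂ _≤_ (lookup-∷ʳ-fromℕ xs x) (toℕ-fromℕ k) (inv (fromℕ k))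

inversionSequences : ∀ k → Finite (InversionSequence {k})
inversionSequences zero = record
  { elements = [] ∷ []
  ; unique   = [] ∷ []
  ; sound    = λ _ ()
  ; complete = λ { {[]} _ → here refl }
  }
inversionSequences (suc k) = record
  { elements = List.cartesianProductWith _∷ʳ_ elements (List.upTo (suc k))
  ; unique   = Unique.cartesianProductWith⁺ _∷ʳ_ (Vec.∷ʳ-injective _ _)
                 unique (Unique.upTo⁺ (suc k))
  ; sound    = snd
  ; complete = cmp
  }
  where
  open Finite (inversionSequences k)

  snd : ∀ {e} → e ∈ List.cartesianProductWith _∷ʳ_ elements (List.upTo (suc k)) →
        InversionSequence e
  snd p with xs , x , xs∈ , x∈ , refl ← ∈-cartesianProductWith⁻ _∷ʳ_ elements _ p =
    inversionSequence-∷ʳ⁺ xs (sound xs∈) (ℕ.≤-pred (∈-upTo⁻ x∈))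

  cmp : ∀ {e} → InversionSequence e →
        e ∈ List.cartesianProductWith _∷ʳ_ elements (List.upTo (suc k))
  cmp {e} inv with xs , x , refl ← Vec.initLast e =
    let inv′ , x≤k = inversionSequence-∷ʳ⁻ xs inv in
    ∈-cartesianProductWith⁺ _∷ʳ_ (complete inv′) (∈-upTo⁺ (s≤s x≤k))

Avoider : ∀ {k} → List Pattern → Vec ℕ k → Set
Avoider B e = InversionSequence e × Avoids e B

avoiders : ∀ B k → Finite (Avoider {k} B)
avoiders B k = restrict (inversionSequences k) (avoids? B)

I : List Pattern → (n : ℕ) → Pred (Vec ℕ (suc n)) 0ℓ
I B n = Avoider B

∣I_∣ : List Pattern → ℕ → ℕ
∣I B ∣ n = card {P = I B n} (avoiders B (suc n))

-- The generating tree.  The level-n nodes of 𝒯(B) are the elements of I B n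
-- and the parent of a node is its `init`.  The left-to-right order of siblings
-- has no effect on the number of nodes and is not recorded.

ancestor : ∀ {k} ℓ → Vec ℕ (ℓ ℕ.+ k) → Vec ℕ k
ancestor zero    f = f
ancestor (suc ℓ) f = ancestor ℓ (init f)

Subtree : ∀ {k} → List Pattern → Vec ℕ k → (ℓ : ℕ) → Pred (Vec ℕ (ℓ ℕ.+ k)) 0ℓ
Subtree B e ℓ f = Avoider B f × ancestor ℓ f ≡ e

subtree : ∀ {k} B (e : Vec ℕ k) ℓ → Finite (Subtree B e ℓ)
subtree {k} B e ℓ =
  restrict (avoiders B (ℓ ℕ.+ k)) (λ f → Vec.≡-dec ℕ._≟_ (ancestor ℓ f) e)

-- Formal power series in x over ℤ, given by their coefficients

Series : Set
Series = ℕ → ℤ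

infix  4 _≈_
infixl 6 _+_ _-_
infixl 7 _*_ divide
infixr 8 _^_

_≈_ : Series → Series → Set
f ≈ g = ∀ n → f n ≡ g n

const : ℤ → Series
const c zero    = c
const c (suc n) = + 0

x : Series
x 1 = + 1
x _ = + 0

_+_ _-_ _*_ : Series → Series → Series
(f + g) n = f n ℤ.+ g n
(f - g) n = f n ℤ.- g n
(f * g) n = ∑[ i ≤ n ] (f (toℕ i) ℤ.* g (n ∸ toℕ i))

_^_ : Series → ℕ → Series
f ^ zero  = const (+ 1)
f ^ suc n = f * f ^ n

-- Long division: if f = f₀ + x f′ and g = 1 + x g′, then
-- f / g = f₀ + x ((f′ - f₀ g′) / g).
quotient : Series → Series → Series
quotient f g zero    = f 0
quotient f g (suc n) = quotient (λ k → f (suc k) ℤ.- f 0 ℤ.* g (suc k)) g n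

divide : (f g : Series) → .(g 0 ≡ + 1) → Series
divide f g _ = quotient f g

syntax divide f g g₀≡1 = f /⟨ g₀≡1 ⟩ g

divide-correct : ∀ f g (g₀≡1 : g 0 ≡ + 1) → (f /⟨ g₀≡1 ⟩ g) * g ≈ f
divide-correct f g g₀≡1 zero = begin
  f 0 ℤ.* g 0 ℤ.+ + 0  ≡⟨ ℤ.+-identityʳ _ ⟩
  f 0 ℤ.* g 0          ≡⟨ cong (f 0 ℤ.*_) g₀≡1 ⟩
  f 0 ℤ.* + 1          ≡⟨ ℤ.*-identityʳ _ ⟩
  f 0                  ∎
  where open ≡-Reasoning
divide-correct f g g₀≡1 (suc n) = begin
  a ℤ.+ ((f′ /⟨ g₀≡1 ⟩ g) * g) n  ≡⟨ cong (λ z → a ℤ.+ z) (divide-correct f′ g g₀≡1 n) ⟩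
  a ℤ.+ (f (suc n) ℤ.- a)          ≡⟨ cong (λ z → a ℤ.+ z) (ℤ.+-comm (f (suc n)) (ℤ.- a)) ⟩
  a ℤ.+ (ℤ.- a ℤ.+ f (suc n))      ≡⟨ sym (ℤ.+-assoc a _ _) ⟩
  (a ℤ.- a) ℤ.+ f (suc n)          ≡⟨ cong (ℤ._+ f (suc n)) (ℤ.+-inverseʳ a) ⟩
  + 0 ℤ.+ f (suc n)                ≡⟨ ℤ.+-identityˡ _ ⟩
  f (suc n)                        ∎
  where
  open ≡-Reasoning
  a = f 0 ℤ.* g (suc n)
  f′ : Series
  f′ k = f (suc k) ℤ.- f 0 ℤ.* g (suc k)

-- Polynomials in a variable u and power series in a variable v, with
-- coefficients power series in x

Series[u] : Set
Series[u] = List Series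

eval : Series[u] → Series → Series
eval p g = List.foldr (λ c r → c + g * r) (const (+ 0)) p

Series[[v]] : Set
Series[[v]] = ℕ → Series

-- Σᵢ Fᵢ gⁱ.  As g has no constant term, gⁱ is divisible by xⁱ, so only the
-- terms with i ≤ n contribute to the coefficient of xⁿ (see `substitute-tail`).
substitute : Series[[v]] → (g : Series) → .(g 0 ≡ + 0) → Series
substitute F g _ n = ∑[ i ≤ n ] ((F (toℕ i) * g ^ toℕ i) n)

syntax substitute F g g₀≡0 = F ⟦v= g , g₀≡0 ⟧

sum-zero : ∀ {n} (t : Fin n → ℤ) → (∀ i → t i ≡ + 0) → sum t ≡ + 0
sum-zero {n} t t≡0 = trans (sum-cong-≗ t≡0) (sum-replicate-zero n)

^-order : ∀ g → g 0 ≡ + 0 → ∀ {i n} → n < i → (g ^ i) n ≡ + 0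
^-order g g₀≡0 {suc i} {n} (s≤s n≤i) = sum-zero {suc n} _ term
  where
  term : ∀ (j : Fin (suc n)) → g (toℕ j) ℤ.* (g ^ i) (n ∸ toℕ j) ≡ + 0
  term zero    = trans (cong (ℤ._* (g ^ i) n) g₀≡0) (ℤ.*-zeroˡ ((g ^ i) n))
  term (suc j) = trans (cong (g (suc (toℕ j)) ℤ.*_) (^-order g g₀≡0 (lt n j n≤i)))
                       (ℤ.*-zeroʳ (g (suc (toℕ j))))
    where
    lt : ∀ n (j : Fin n) → n ≤ i → n ∸ suc (toℕ j) < i
    lt (suc n) j n<i = ℕ.≤-<-trans (ℕ.m∸n≤m n (toℕ j)) n<i

substitute-tail : ∀ (F : Series[[v]]) g → g 0 ≡ + 0 →
                  ∀ {i n} → n < i → (F i * g ^ i) n ≡ + 0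
substitute-tail F g g₀≡0 {i} {n} n<i = sum-zero {suc n} _ λ j →
  trans (cong (F i (toℕ j) ℤ.*_)
              (^-order g g₀≡0 (ℕ.≤-<-trans (ℕ.m∸n≤m n (toℕ j)) n<i)))
        (ℤ.*-zeroʳ (F i (toℕ j)))

-- Σ_{n ≥ 0} aₙ xⁿ⁺¹
Σxⁿ⁺¹ : (ℕ → ℕ) → Series
Σxⁿ⁺¹ a zero    = + 0
Σxⁿ⁺¹ a (suc n) = + a n

subtreeGF : ∀ {k} → List Pattern → Vec ℕ k → Series
subtreeGF B e = Σxⁿ⁺¹ (λ ℓ → card (subtree B e ℓ))

A[_] : List Pattern → ℕ → Series
A[ B ] m = subtreeGF B (Vec.replicate m 0)

B[_] : List Pattern → ℕ → ℕ → Series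
B[ B ] m j = subtreeGF B (Vec.replicate m 0 ∷ʳ j)

A⟨x,v⟩ : List Pattern → Series[[v]]
A⟨x,v⟩ B i = A[ B ] (suc i)

-- With m = i + 2, the coefficient of vⁱ is Σ_{j=2}^{m} B_{m,j}(x) u^{m-j}.  It is
-- a polynomial in u, which makes u = 1 an admissible substitution; its
-- coefficients are listed by increasing l = m - j, where 0 ≤ l ≤ i.
B⟨x,v,u⟩ : List Pattern → ℕ → Series[u]
B⟨x,v,u⟩ B i = List.applyUpTo (λ l → B[ B ] (2 ℕ.+ i) (2 ℕ.+ i ∸ l)) (suc i)

A⟨x,0⟩ : List Pattern → Series
A⟨x,0⟩ B = A⟨x,v⟩ B ⟦v= const (+ 0) , refl ⟧

B⟨x,2x,1⟩ : List Pattern → Series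
B⟨x,2x,1⟩ B =
  (λ i → eval (B⟨x,v,u⟩ B i) (const (+ 1))) ⟦v= const (+ 2) * x , refl ⟧

𝟐𝟎𝟏 : Pattern
𝟐𝟎𝟏 = 3 , 2 ∷ 0 ∷ 1 ∷ []

{-# OPTIONS --safe #-}
module Submission where

-- The children of the node 0ᵐ are the nodes 0ᵐj with 0 ≤ j ≤ m.  An occurrence
-- of 201 begins with a letter that is at least 2, so a prefix with all letters
-- in {0, 1} takes no part in it, and any two such prefixes of equal length have
-- equally many extensions of each length (`card-binary`).  For m ≥ 1 the subtrees
-- at 0ᵐ0 and 0ᵐ1 therefore both have generating function A_{m+1}, and counting
-- the subtree at 0ᵐ by the children of its root (`card-children`) gives
--
--   A_m = x + 2x A_{m+1} + x Σ_{j=2}^m B_{m,j}        (`A-recurrence`).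
--
-- As 2x has no constant term, the recurrence can be iterated indefinitely
-- (`unroll`).  From A_2 on this gives A_2 = x / (1 - 2x) + x B(x,2x,1), and as
-- the sum over j is empty for m = 1,
--
--   A(x,0) = A_1 = x + 2x A_2 = x / (1 - 2x) + 2x² B(x,2x,1).
--
-- Cardinalities are compared along explicit bijections (`card-bijection`), and
-- identities of series are proved coefficient by coefficient.

open import Defs
open import Data.Integer.Base using (+_)
open import Data.List.Base using ([_])
open import Data.Product.Base using (_×_)
open import Relation.Binary.PropositionalEquality using (refl)
open import Data.Fin.Base using (zero; suc; toℕ)
open import Data.Integer.Base as ℤ using (ℤ)
import Data.Integer.Properties as ℤ
open import Data.Integer.Tactic.RingSolver using (solve-∀)
open import Data.List.Base as List using (List; []; _∷_; applyUpTo; downFrom)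
import Data.List.Properties as List
open import Data.List.Membership.Propositional using (_∈_)
open import Data.List.Membership.Propositional.Properties
  using (∈-map⁺; ∈-map⁻; ∈-++⁺ˡ; ∈-++⁺ʳ; ∈-++⁻; ∈-downFrom⁺; ∈-downFrom⁻)
open import Data.List.Membership.Propositional.Properties.WithK using (unique∧set⇒bag)
open import Data.List.Relation.Binary.BagAndSetEquality using (∼bag⇒↭)
open import Data.List.Relation.Binary.Permutation.Propositional.Properties using (↭-length)
import Data.List.Relation.Binary.Sublist.Propositional as Sub
open Sub using (_⊆_)
import Data.List.Relation.Binary.Sublist.Propositional.Properties as Sub
open import Data.List.Relation.Unary.All as All using (All; []; _∷_)
import Data.List.Relation.Unary.All.Properties as All
open import Data.List.Relation.Unary.AllPairs using ([]; _∷_)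
open import Data.List.Relation.Unary.Any using (here; there)
open import Data.List.Relation.Unary.Unique.Propositional using (Unique)
import Data.List.Relation.Unary.Unique.Propositional.Properties as Unique
open import Data.Nat.Base as ℕ using (ℕ; zero; suc; _≤_; _<_; z≤n; s≤s; _∸_)
import Data.Nat.ListAction as ℕ
import Data.Nat.Properties as ℕ
open import Data.Product.Base using (_,_; proj₁; proj₂)
open import Data.Sum.Base using (inj₁; inj₂)
open import Data.Vec.Base as Vec using (Vec; []; _∷_; _∷ʳ_; cast; toList; init; last)
import Data.Vec.Properties as Vec
open import Function.Base using (_∘_; id)
open import Function.Bundles using (mk⇔; Equivalence)
open import Level using (0ℓ)
open import Relation.Binary.PropositionalEquality
  using (_≡_; _≢_; sym; trans; cong; cong₂; subst; module ≡-Reasoning)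
open import Relation.Nullary using (¬_; contradiction)
open import Relation.Unary using (Pred)

open import Algebra.Properties.Semiring.Sum ℤ.+-*-semiring
  using (sum; sum-cong-≗; *-distribˡ-sum)

open ≡-Reasoning

-- Cardinalities of finite predicates

module _ {A B : Set} {P : Pred A 0ℓ} {Q : Pred B 0ℓ} where

  unique-map : (f : A → B) (g : B → A) → (∀ {a} → P a → g (f a) ≡ a) →
               ∀ {as} → All P as → Unique as → Unique (List.map f as)
  unique-map f g gf []              []       = []
  unique-map f g gf {a ∷ _} (pa ∷ pas) (a∉ ∷ u) =
    All.map⁺ (All.zipWith distinct (a∉ , pas)) ∷ unique-map f g gf pas u
    where
    distinct : ∀ {b} → a ≢ b × P b → f a ≢ f b
    distinct (a≢b , pb) eq =
      a≢b (trans (sym (gf pa)) (trans (cong g eq) (gf pb)))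

  -- The two maps need only be mutually inverse on P and Q.
  card-bijection : (p : Finite P) (q : Finite Q) (f : A → B) (g : B → A) →
                   (∀ {a} → P a → Q (f a)) → (∀ {b} → Q b → P (g b)) →
                   (∀ {a} → P a → g (f a) ≡ a) → (∀ {b} → Q b → f (g b) ≡ b) →
                   card p ≡ card q
  card-bijection p q f g P⇒Q Q⇒P gf fg = begin
    List.length p.elements               ≡⟨ List.length-map f p.elements ⟨
    List.length (List.map f p.elements)  ≡⟨ ↭-length (∼bag⇒↭ (unique∧set⇒bag
      (unique-map f g gf (All.tabulate p.sound) p.unique) q.unique (mk⇔ to from))) ⟩
    List.length q.elements               ∎
    where
    module p = Finite p
    module q = Finite q

    to : ∀ {b} → b ∈ List.map f p.elements → b ∈ q.elements
    to b∈ with a , a∈ , refl ← ∈-map⁻ f b∈ = q.complete (P⇒Q (p.sound a∈))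

    from : ∀ {b} → b ∈ q.elements → b ∈ List.map f p.elements
    from b∈ = let Qb = q.sound b∈ in
      subst (_∈ List.map f p.elements) (fg Qb) (∈-map⁺ f (p.complete (Q⇒P Qb)))

singleton : ∀ {A : Set} (a : A) → Finite (_≡ a)
singleton a = record
  { elements = [ a ]
  ; unique   = [] ∷ []
  ; sound    = λ { (here eq) → eq }
  ; complete = here
  }

module _ {A : Set} {Q : ℕ → Pred A 0ℓ} (fin : ∀ j → Finite (Q j)) where

  -- The disjoint union of the Q j over the indices j in a list
  disjointUnion : ∀ {js} → Unique js → Finite (λ (j , a) → j ∈ js × Q j a)
  disjointUnion [] = record
    { elements = [] ; unique = [] ; sound = λ () ; complete = λ () }
  disjointUnion {j ∷ js} u@(_ ∷ u′) = record
    { elements = List.map (j ,_) head.elements List.++ tail.elements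
    ; unique   = Unique.++⁺ (Unique.map⁺ (λ { refl → refl }) head.unique) tail.unique disjoint
    ; sound    = snd
    ; complete = cmp
    }
    where
    module head = Finite (fin j)
    module tail = Finite (disjointUnion u′)

    disjoint : ∀ {b} → b ∈ List.map (j ,_) head.elements × b ∈ tail.elements → _
    disjoint (b∈ , b∈′) with _ , _ , refl ← ∈-map⁻ (j ,_) b∈ =
      Unique.Unique[x∷xs]⇒x∉xs u (proj₁ (tail.sound b∈′))

    snd : ∀ {b} → b ∈ List.map (j ,_) head.elements List.++ tail.elements →
          proj₁ b ∈ j ∷ js × Q (proj₁ b) (proj₂ b)
    snd b∈ with ∈-++⁻ (List.map (j ,_) head.elements) b∈
    ... | inj₁ b∈ˡ with a , a∈ , refl ← ∈-map⁻ (j ,_) b∈ˡ = here refl , head.sound a∈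
    ... | inj₂ b∈ʳ with i∈ , q ← tail.sound b∈ʳ = there i∈ , q

    cmp : ∀ {b} → proj₁ b ∈ j ∷ js × Q (proj₁ b) (proj₂ b) →
          b ∈ List.map (j ,_) head.elements List.++ tail.elements
    cmp (here refl , q) = ∈-++⁺ˡ (∈-map⁺ (j ,_) (head.complete q))
    cmp (there i∈ , q)  = ∈-++⁺ʳ _ (tail.complete (i∈ , q))

  card-disjointUnion : ∀ {js} (u : Unique js) →
    card (disjointUnion u) ≡ ℕ.sum (List.map (λ j → card (fin j)) js)
  card-disjointUnion []                = refl
  card-disjointUnion {j ∷ js} (_ ∷ u′) = trans
    (List.length-++ (List.map (j ,_) (Finite.elements (fin j))))
    (cong₂ ℕ._+_ (List.length-map (j ,_) (Finite.elements (fin j))) (card-disjointUnion u′))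

-- Ancestors in the generating tree

module _ {A : Set} where

  init-∷ʳ-last : ∀ {n} (f : Vec A (suc n)) → f ≡ init f ∷ʳ last f
  init-∷ʳ-last f = proj₂ (proj₂ (Vec.initLast f))

  cast-inverse : ∀ {m n} .(eq : m ≡ n) .(eq′ : n ≡ m) (f : Vec A m) →
                 cast eq′ (cast eq f) ≡ f
  cast-inverse eq eq′ f =
    trans (Vec.cast-trans eq eq′ f) (Vec.cast-is-id (trans eq eq′) f)

  init-cast : ∀ {m n} .(eq : suc m ≡ suc n) (f : Vec A (suc m)) →
              init (cast eq f) ≡ cast (cong ℕ.pred eq) (init f)
  init-cast eq f = begin
    init (cast eq f)                     ≡⟨ cong (init ∘ cast eq) (init-∷ʳ-last f) ⟩
    init (cast eq (init f ∷ʳ last f))    ≡⟨ cong init (Vec.cast-∷ʳ eq (last f) (init f)) ⟩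
    init (cast _ (init f) ∷ʳ last f)     ≡⟨ Vec.init-∷ʳ (last f) _ ⟩
    cast (cong ℕ.pred eq) (init f)       ∎

init-ancestor : ∀ {k} ℓ (f : Vec ℕ (suc (ℓ ℕ.+ k))) .(eq : suc (ℓ ℕ.+ k) ≡ ℓ ℕ.+ suc k) →
                init (ancestor ℓ (cast eq f)) ≡ ancestor ℓ (init f)
init-ancestor zero    f eq = cong init (Vec.cast-is-id eq f)
init-ancestor (suc ℓ) f eq = trans
  (cong (init ∘ ancestor ℓ) (init-cast eq f))
  (init-ancestor ℓ (init f) (cong ℕ.pred eq))

inversionSequence-init : ∀ {n} (f : Vec ℕ (suc n)) →
  InversionSequence f → InversionSequence (init f) × last f ≤ n
inversionSequence-init f inv =
  inversionSequence-∷ʳ⁻ (init f) (subst InversionSequence (init-∷ʳ-last f) inv)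

inversionSequence-ancestor : ∀ {k} ℓ (f : Vec ℕ (ℓ ℕ.+ k)) →
  InversionSequence f → InversionSequence (ancestor ℓ f)
inversionSequence-ancestor zero    f inv = inv
inversionSequence-ancestor (suc ℓ) f inv =
  inversionSequence-ancestor ℓ (init f) (proj₁ (inversionSequence-init f inv))

avoider-cast : ∀ {B m n} (eq : m ≡ n) {f : Vec ℕ m} → Avoider B f → Avoider B (cast eq f)
avoider-cast {B} refl {f} = subst (Avoider B) (sym (Vec.cast-is-id refl f))

-- Decomposition of a subtree at its root

card-root : ∀ {B k} {e : Vec ℕ k} → Avoider B e → card (subtree B e 0) ≡ 1
card-root {B} {e = e} av = card-bijection (subtree B e 0) (singleton e) id id
  proj₂ (λ { refl → av , refl }) (λ _ → refl) (λ _ → refl)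

-- A node at distance ℓ + 1 below e lies at distance ℓ below exactly one child
-- of e.  The type of `ancestor` makes the two lengths ℓ + 1 + k and
-- ℓ + (1 + k) differ by a `cast`.
card-children : ∀ B {k} (e : Vec ℕ k) ℓ →
  card (subtree B e (suc ℓ)) ≡
  ℕ.sum (List.map (λ j → card (subtree B (e ∷ʳ j) ℓ)) (downFrom (suc k)))
card-children B {k} e ℓ = trans
  (card-bijection (subtree B e (suc ℓ)) (disjointUnion children (Unique.downFrom⁺ (suc k)))
    (λ f → last (ancestor ℓ (cast eq f)) , cast eq f)
    (λ (_ , f) → cast (sym eq) f)
    to from
    (λ {f} _ → cast-inverse eq (sym eq) f)
    (λ { {j , f} (_ , _ , anc) → cong₂ _,_
           (trans (cong (last ∘ ancestor ℓ) (cast-inverse (sym eq) eq f))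
                  (trans (cong last anc) (Vec.last-∷ʳ j e)))
           (cast-inverse (sym eq) eq f) }))
  (card-disjointUnion children (Unique.downFrom⁺ (suc k)))
  where
  eq : suc (ℓ ℕ.+ k) ≡ ℓ ℕ.+ suc k
  eq = sym (ℕ.+-suc ℓ k)

  children : ∀ j → Finite (Subtree B (e ∷ʳ j) ℓ)
  children j = subtree B (e ∷ʳ j) ℓ

  to : ∀ {f} → Subtree B e (suc ℓ) f →
       let j = last (ancestor ℓ (cast eq f)) in
       j ∈ downFrom (suc k) × Subtree B (e ∷ʳ j) ℓ (cast eq f)
  to {f} (av , anc) with av′ ← avoider-cast eq av =
    ∈-downFrom⁺ (s≤s (proj₂ (inversionSequence-init f′
      (inversionSequence-ancestor ℓ (cast eq f) (proj₁ av′))))) ,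
    av′ , trans (init-∷ʳ-last f′) (cong (_∷ʳ last f′) (trans (init-ancestor ℓ f eq) anc))
    where f′ = ancestor ℓ (cast eq f)

  from : ∀ {b} → proj₁ b ∈ downFrom (suc k) × Subtree B (e ∷ʳ proj₁ b) ℓ (proj₂ b) →
         Subtree B e (suc ℓ) (cast (sym eq) (proj₂ b))
  from {j , f} (_ , av , anc) = avoider-cast (sym eq) av , (begin
    ancestor ℓ (init (cast (sym eq) f))            ≡⟨ init-ancestor ℓ (cast (sym eq) f) eq ⟨
    init (ancestor ℓ (cast eq (cast (sym eq) f)))
      ≡⟨ cong (init ∘ ancestor ℓ) (cast-inverse (sym eq) eq f) ⟩
    init (ancestor ℓ f)                            ≡⟨ cong init anc ⟩
    init (e ∷ʳ j)                                  ≡⟨ Vec.init-∷ʳ j e ⟩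
    e                                              ∎)

-- The only inversion sequence of length 1 is 0, so every node lies below the root.
card-tree : ∀ B n → ∣I B ∣ n ≡ card (subtree B (Vec.replicate 1 0) n)
card-tree B n = card-bijection (avoiders B (suc n)) (subtree B (0 ∷ []) n)
  (cast eq) (cast (sym eq))
  (λ av → let av′ = avoider-cast eq av in
          av′ , only-root _ (inversionSequence-ancestor n _ (proj₁ av′)))
  (avoider-cast (sym eq) ∘ proj₁)
  (λ {f} _ → cast-inverse eq (sym eq) f)
  (λ {f} _ → cast-inverse (sym eq) eq f)
  where
  eq : suc n ≡ n ℕ.+ 1
  eq = ℕ.+-comm 1 n

  only-root : (e : Vec ℕ 1) → InversionSequence e → e ≡ 0 ∷ []
  only-root (a ∷ []) inv = cong (_∷ []) (ℕ.n≤0⇒n≡0 (inv zero))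

-- Replacing a prefix

-- The word obtained from f by replacing its prefix `ancestor ℓ f` by e
graft : ∀ {k} ℓ → Vec ℕ k → Vec ℕ (ℓ ℕ.+ k) → Vec ℕ (ℓ ℕ.+ k)
graft zero    e f = e
graft (suc ℓ) e f = graft ℓ e (init f) ∷ʳ last f

-- The last ℓ letters of f
suffix : ∀ {k} ℓ → Vec ℕ (ℓ ℕ.+ k) → List ℕ
suffix zero    f = []
suffix (suc ℓ) f = suffix ℓ (init f) List.++ [ last f ]

ancestor-graft : ∀ {k} ℓ (e : Vec ℕ k) f → ancestor ℓ (graft ℓ e f) ≡ e
ancestor-graft zero    e f = refl
ancestor-graft (suc ℓ) e f = trans
  (cong (ancestor ℓ) (Vec.init-∷ʳ (last f) (graft ℓ e (init f))))
  (ancestor-graft ℓ e (init f))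

graft-ancestor : ∀ {k} ℓ (f : Vec ℕ (ℓ ℕ.+ k)) → graft ℓ (ancestor ℓ f) f ≡ f
graft-ancestor zero    f = refl
graft-ancestor (suc ℓ) f = trans
  (cong (_∷ʳ last f) (graft-ancestor ℓ (init f))) (sym (init-∷ʳ-last f))

graft-graft : ∀ {k} ℓ (e e′ : Vec ℕ k) f → graft ℓ e (graft ℓ e′ f) ≡ graft ℓ e f
graft-graft zero    e e′ f = refl
graft-graft (suc ℓ) e e′ f = cong₂ _∷ʳ_
  (trans (cong (graft ℓ e) (Vec.init-∷ʳ (last f) f′)) (graft-graft ℓ e e′ (init f)))
  (Vec.last-∷ʳ (last f) f′)
  where f′ = graft ℓ e′ (init f)

toList-graft : ∀ {k} ℓ (e : Vec ℕ k) f →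
               toList (graft ℓ e f) ≡ toList e List.++ suffix ℓ f
toList-graft zero    e f = sym (List.++-identityʳ (toList e))
toList-graft (suc ℓ) e f = begin
  toList (graft ℓ e (init f) ∷ʳ last f)
    ≡⟨ Vec.toList-∷ʳ (last f) (graft ℓ e (init f)) ⟩
  toList (graft ℓ e (init f)) List.++ [ last f ]
    ≡⟨ cong (List._++ [ last f ]) (toList-graft ℓ e (init f)) ⟩
  (toList e List.++ suffix ℓ (init f)) List.++ [ last f ]
    ≡⟨ List.++-assoc (toList e) (suffix ℓ (init f)) [ last f ] ⟩
  toList e List.++ (suffix ℓ (init f) List.++ [ last f ])  ∎

suffix⊆ : ∀ {k} ℓ (f : Vec ℕ (ℓ ℕ.+ k)) → suffix ℓ f ⊆ toList f
suffix⊆ ℓ f = subst (suffix ℓ f ⊆_)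
  (trans (sym (toList-graft ℓ (ancestor ℓ f) f)) (cong toList (graft-ancestor ℓ f)))
  (Sub.++⁺ˡ (toList (ancestor ℓ f)) Sub.⊆-refl)

inversionSequence-graft : ∀ {k} ℓ {e : Vec ℕ k} {f} →
  InversionSequence e → InversionSequence f → InversionSequence (graft ℓ e f)
inversionSequence-graft zero    inve invf = inve
inversionSequence-graft (suc ℓ) {e} {f} inve invf =
  let invf′ , last≤ = inversionSequence-init f invf in
  inversionSequence-∷ʳ⁺ (graft ℓ e (init f)) (inversionSequence-graft ℓ inve invf′) last≤

drop-prefix : ∀ {a b c p s} → All (_≤ 1) p → b < c → c < a →
              (a ∷ b ∷ c ∷ []) ⊆ p List.++ s → (a ∷ b ∷ c ∷ []) ⊆ s
drop-prefix []         b<c c<a σ              = σ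
drop-prefix (_ ∷ p≤1)  b<c c<a (_ Sub.∷ʳ σ)   = drop-prefix p≤1 b<c c<a σ
drop-prefix (a≤1 ∷ _)  b<c c<a (refl Sub.∷ _) =
  contradiction (ℕ.≤-trans b<c (ℕ.≤-pred (ℕ.≤-trans c<a a≤1))) ℕ.n≮0

-- An occurrence of 201 in a word does not use a prefix with letters at most 1:
-- its first letter is at least 2, and the other two come later.
occurrence-in-suffix : ∀ {p s} (t : Vec ℕ 3) → All (_≤ 1) p →
  OrderIsomorphic t (proj₂ 𝟐𝟎𝟏) → toList t ⊆ p List.++ s → toList t ⊆ s
occurrence-in-suffix (a ∷ b ∷ c ∷ []) p≤1 iso = drop-prefix p≤1
  (Equivalence.from (proj₁ (iso (suc zero) (suc (suc zero)))) (s≤s z≤n))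
  (Equivalence.from (proj₁ (iso (suc (suc zero)) zero)) (s≤s (s≤s z≤n)))

contains-graft : ∀ {k} ℓ {e : Vec ℕ k} {f} → All (_≤ 1) (toList e) →
                 Contains (graft ℓ e f) 𝟐𝟎𝟏 → Contains f 𝟐𝟎𝟏
contains-graft ℓ {e} {f} e≤1 (t , σ , iso) =
  t , Sub.⊆-trans (occurrence-in-suffix t e≤1 iso (subst (toList t ⊆_) (toList-graft ℓ e f) σ))
                  (suffix⊆ ℓ f) , iso

-- Inversion sequences with letters in {0, 1}
Binary : ∀ {k} → Vec ℕ k → Set
Binary e = InversionSequence e × All (_≤ 1) (toList e)

binary-∷ʳ : ∀ {k} {e : Vec ℕ k} {j} → Binary e → j ≤ k → j ≤ 1 → Binary (e ∷ʳ j)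
binary-∷ʳ {e = e} {j} (inv , e≤1) j≤k j≤1 =
  inversionSequence-∷ʳ⁺ e inv j≤k ,
  subst (All (_≤ 1)) (sym (Vec.toList-∷ʳ j e)) (All.++⁺ e≤1 (j≤1 ∷ []))

binary-zeros : ∀ m → Binary (Vec.replicate m 0)
binary-zeros m =
  (λ i → subst (_≤ toℕ i) (sym (Vec.lookup-replicate i 0)) z≤n) , zeros≤1 m
  where
  zeros≤1 : ∀ m → All (_≤ 1) (toList (Vec.replicate m 0))
  zeros≤1 zero    = []
  zeros≤1 (suc m) = z≤n ∷ zeros≤1 m

binary-avoider : ∀ {k} {e : Vec ℕ k} → Binary e → Avoider [ 𝟐𝟎𝟏 ] e
binary-avoider {e = e} (inv , e≤1) = inv , avoid ∷ []
  where
  avoid : ¬ Contains e 𝟐𝟎𝟏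
  -- Here e is all prefix, and the suffix is empty.
  avoid (t@(_ ∷ _) , σ , iso)
    with () ← occurrence-in-suffix t e≤1 iso (subst (toList t ⊆_) (sym (List.++-identityʳ (toList e))) σ)

-- Binary nodes of equal length have subtrees with the same level sizes.
card-binary : ∀ {k} {e e′ : Vec ℕ k} → Binary e → Binary e′ → ∀ ℓ →
              card (subtree [ 𝟐𝟎𝟏 ] e ℓ) ≡ card (subtree [ 𝟐𝟎𝟏 ] e′ ℓ)
card-binary {e = e} {e′} be be′ ℓ = card-bijection (subtree _ e ℓ) (subtree _ e′ ℓ)
  (graft ℓ e′) (graft ℓ e) (move be′) (move be) (back e e′) (back e′ e)
  where
  move : ∀ {e e′ f} → Binary e′ → Subtree [ 𝟐𝟎𝟏 ] e ℓ f →
         Subtree [ 𝟐𝟎𝟏 ] e′ ℓ (graft ℓ e′ f)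
  move {e′ = e′} {f} (inv , e′≤1) ((invf , avoid ∷ []) , _) =
    (inversionSequence-graft ℓ inv invf , (avoid ∘ contains-graft ℓ e′≤1) ∷ []) ,
    ancestor-graft ℓ e′ f

  back : ∀ e e′ {f} → Subtree [ 𝟐𝟎𝟏 ] e ℓ f → graft ℓ e (graft ℓ e′ f) ≡ f
  back e e′ {f} (_ , refl) = trans (graft-graft ℓ e e′ f) (graft-ancestor ℓ f)

-- Power series arithmetic

const-*-coeff : ∀ c f n → (const c * f) n ≡ c ℤ.* f n
const-*-coeff c f zero    = ℤ.+-identityʳ _
const-*-coeff c f (suc n) = trans
  (cong (λ z → c ℤ.* f (suc n) ℤ.+ z)
        (sum-zero {suc n} _ λ i → ℤ.*-zeroˡ (f (n ∸ toℕ i))))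
  (ℤ.+-identityʳ _)

*-const1-coeff : ∀ f n → (f * const (+ 1)) n ≡ f n
*-const1-coeff f zero    = trans (ℤ.+-identityʳ _) (ℤ.*-identityʳ (f 0))
*-const1-coeff f (suc n) = trans
  (cong₂ ℤ._+_ (ℤ.*-zeroʳ (f 0)) (*-const1-coeff (f ∘ suc) n)) (ℤ.+-identityˡ _)

*-congˡ-coeff : ∀ {f g : Series} h → f ≈ g → f * h ≈ g * h
*-congˡ-coeff h f≈g n =
  sum-cong-≗ {suc n} λ i → cong (ℤ._* h (n ∸ toℕ i)) (f≈g (toℕ i))

-- A series without constant term is x times its shift.
*-shift : ∀ (f h : Series) → f 0 ≡ + 0 → ∀ n → (f * h) (suc n) ≡ ((f ∘ suc) * h) n
*-shift f h f₀ n = trans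
  (cong (λ z → z ℤ.* h (suc n) ℤ.+ ((f ∘ suc) * h) n) f₀)
  (trans (cong (ℤ._+ ((f ∘ suc) * h) n) (ℤ.*-zeroˡ (h (suc n)))) (ℤ.+-identityˡ _))

-- g is the monomial cx, for a constant c that may be 0.
record IsLinear (c : ℤ) (g : Series) : Set where
  field
    coeff₀ : g 0 ≡ + 0
    coeff₊ : g ∘ suc ≈ const c

module _ {c g} (linear : IsLinear c g) where
  open IsLinear linear

  linear-*-coeff₀ : ∀ h → (g * h) 0 ≡ + 0
  linear-*-coeff₀ h = trans (ℤ.+-identityʳ _)
    (trans (cong (ℤ._* h 0) coeff₀) (ℤ.*-zeroˡ (h 0)))

  linear-*-coeff₊ : ∀ h n → (g * h) (suc n) ≡ c ℤ.* h n
  linear-*-coeff₊ h n = begin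
    (g * h) (suc n)     ≡⟨ *-shift g h coeff₀ n ⟩
    ((g ∘ suc) * h) n   ≡⟨ *-congˡ-coeff h coeff₊ n ⟩
    (const c * h) n     ≡⟨ const-*-coeff c h n ⟩
    c ℤ.* h n           ∎

  *-linear-coeff : ∀ f h n → (f * (g * h)) (suc n) ≡ c ℤ.* (f * h) n
  *-linear-coeff f h zero = begin
    f 0 ℤ.* (g * h) 1 ℤ.+ (f 1 ℤ.* (g * h) 0 ℤ.+ + 0)
      ≡⟨ cong₂ (λ y z → f 0 ℤ.* y ℤ.+ (f 1 ℤ.* z ℤ.+ + 0))
               (linear-*-coeff₊ h 0) (linear-*-coeff₀ h) ⟩
    f 0 ℤ.* (c ℤ.* h 0) ℤ.+ (f 1 ℤ.* + 0 ℤ.+ + 0)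
      ≡⟨ rearrange (f 0) (f 1) c (h 0) ⟩
    c ℤ.* (f 0 ℤ.* h 0 ℤ.+ + 0)  ∎
    where
    rearrange : ∀ a b c d → a ℤ.* (c ℤ.* d) ℤ.+ (b ℤ.* + 0 ℤ.+ + 0) ≡ c ℤ.* (a ℤ.* d ℤ.+ + 0)
    rearrange = solve-∀
  *-linear-coeff f h (suc n) = begin
    f 0 ℤ.* (g * h) (2 ℕ.+ n) ℤ.+ ((f ∘ suc) * (g * h)) (suc n)
      ≡⟨ cong₂ (λ y z → f 0 ℤ.* y ℤ.+ z)
               (linear-*-coeff₊ h (suc n)) (*-linear-coeff (f ∘ suc) h n) ⟩
    f 0 ℤ.* (c ℤ.* h (suc n)) ℤ.+ c ℤ.* ((f ∘ suc) * h) n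
      ≡⟨ rearrange (f 0) c (h (suc n)) (((f ∘ suc) * h) n) ⟩
    c ℤ.* (f 0 ℤ.* h (suc n) ℤ.+ ((f ∘ suc) * h) n)  ∎
    where
    rearrange : ∀ a c d e → a ℤ.* (c ℤ.* d) ℤ.+ c ℤ.* e ≡ c ℤ.* (a ℤ.* d ℤ.+ e)
    rearrange = solve-∀

  -- The two coefficient lemmas say that F(cx) = F₀ + cx F⁺(cx), where F = F₀ + v F⁺.
  substitute-coeff₀ : ∀ F → (F ⟦v= g , coeff₀ ⟧) 0 ≡ F 0 0
  substitute-coeff₀ F = trans (ℤ.+-identityʳ _) (*-const1-coeff (F 0) 0)

  substitute-coeff₊ : ∀ F n →
    (F ⟦v= g , coeff₀ ⟧) (suc n) ≡ F 0 (suc n) ℤ.+ c ℤ.* ((F ∘ suc) ⟦v= g , coeff₀ ⟧) n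
  substitute-coeff₊ F n = cong₂ ℤ._+_ (*-const1-coeff (F 0) (suc n)) (begin
    sum {suc n} (λ i → (F (suc (toℕ i)) * (g * g ^ toℕ i)) (suc n))
      ≡⟨ sum-cong-≗ {suc n} (λ i → *-linear-coeff (F (suc (toℕ i))) (g ^ toℕ i) n) ⟩
    sum {suc n} (λ i → c ℤ.* (F (suc (toℕ i)) * g ^ toℕ i) n)
      ≡⟨ *-distribˡ-sum {suc n} c (λ i → (F (suc (toℕ i)) * g ^ toℕ i) n) ⟨
    c ℤ.* ((F ∘ suc) ⟦v= g , coeff₀ ⟧) n  ∎)

  -- The solution of the functional equation
  -- αᵢ = x + cx αᵢ₊₁ + x Fᵢ is α₀ = x / (1 - cx) + x F(cx).
  unroll : ∀ (α F : ℕ → Series) → (∀ i → α i 0 ≡ + 0) →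
    (∀ i n → α i (suc n) ≡ const (+ 1) n ℤ.+ c ℤ.* α (suc i) n ℤ.+ F i n) →
    ∀ n → α 0 (suc n) ≡ c ℤ.^ n ℤ.+ (F ⟦v= g , coeff₀ ⟧) n
  unroll α F α₀ rec zero = begin
    α 0 1                                  ≡⟨ rec 0 0 ⟩
    + 1 ℤ.+ c ℤ.* α 1 0 ℤ.+ F 0 0          ≡⟨ cong (λ z → + 1 ℤ.+ c ℤ.* z ℤ.+ F 0 0) (α₀ 1) ⟩
    + 1 ℤ.+ c ℤ.* + 0 ℤ.+ F 0 0            ≡⟨ cong (λ z → + 1 ℤ.+ z ℤ.+ F 0 0) (ℤ.*-zeroʳ c) ⟩
    + 1 ℤ.+ F 0 0                          ≡⟨ cong (λ z → + 1 ℤ.+ z) (substitute-coeff₀ F) ⟨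
    + 1 ℤ.+ (F ⟦v= g , coeff₀ ⟧) 0         ∎
  unroll α F α₀ rec (suc n) = begin
    α 0 (2 ℕ.+ n)
      ≡⟨ rec 0 (suc n) ⟩
    + 0 ℤ.+ c ℤ.* α 1 (suc n) ℤ.+ F 0 (suc n)
      ≡⟨ cong (λ z → + 0 ℤ.+ c ℤ.* z ℤ.+ F 0 (suc n))
              (unroll (α ∘ suc) (F ∘ suc) (α₀ ∘ suc) (rec ∘ suc) n) ⟩
    + 0 ℤ.+ c ℤ.* (c ℤ.^ n ℤ.+ F⁺ n) ℤ.+ F 0 (suc n)
      ≡⟨ rearrange c (c ℤ.^ n) (F⁺ n) (F 0 (suc n)) ⟩
    c ℤ.* c ℤ.^ n ℤ.+ (F 0 (suc n) ℤ.+ c ℤ.* F⁺ n)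
      ≡⟨ cong (λ z → c ℤ.* c ℤ.^ n ℤ.+ z) (substitute-coeff₊ F n) ⟨
    c ℤ.* c ℤ.^ n ℤ.+ (F ⟦v= g , coeff₀ ⟧) (suc n)  ∎
    where
    F⁺ = (F ∘ suc) ⟦v= g , coeff₀ ⟧
    rearrange : ∀ c p q r → + 0 ℤ.+ c ℤ.* (p ℤ.+ q) ℤ.+ r ≡ c ℤ.* p ℤ.+ (r ℤ.+ c ℤ.* q)
    rearrange = solve-∀

linear-2x : IsLinear (+ 2) (const (+ 2) * x)
linear-2x = record { coeff₀ = refl ; coeff₊ = coeff₊ }
  where
  coeff₊ : (const (+ 2) * x) ∘ suc ≈ const (+ 2)
  coeff₊ zero    = refl
  coeff₊ (suc n) = const-*-coeff (+ 2) x (2 ℕ.+ n)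

linear-0 : IsLinear (+ 0) (const (+ 0))
linear-0 = record { coeff₀ = refl ; coeff₊ = λ { zero → refl ; (suc n) → refl } }

linear-x : IsLinear (+ 1) x
linear-x = record { coeff₀ = refl ; coeff₊ = λ { zero → refl ; (suc n) → refl } }

substitute-0 : ∀ F → F ⟦v= const (+ 0) , refl ⟧ ≈ F 0
substitute-0 F zero    = substitute-coeff₀ linear-0 F
substitute-0 F (suc n) = trans (substitute-coeff₊ linear-0 F n)
  (trans (cong (λ z → F 0 (suc n) ℤ.+ z) (ℤ.*-zeroˡ (((F ∘ suc) ⟦v= const (+ 0) , refl ⟧) n)))
         (ℤ.+-identityʳ _))

-- d / (1 - cx) = Σₙ d cⁿ xⁿ
quotient-geometric : ∀ {c d f g} → f 0 ≡ d → (∀ n → f (suc n) ≡ + 0) →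
  (∀ n → g (suc n) ≡ const (ℤ.- c) n) → ∀ n → quotient f g n ≡ d ℤ.* c ℤ.^ n
quotient-geometric {d = d} f₀ f₊ g₊ zero = trans f₀ (sym (ℤ.*-identityʳ d))
quotient-geometric {c} {d} {f} {g} f₀ f₊ g₊ (suc n) = trans
  (quotient-geometric {c} {d ℤ.* c}
    (begin
      f 1 ℤ.- f 0 ℤ.* g 1     ≡⟨ cong₂ ℤ._-_ (f₊ 0) (cong₂ ℤ._*_ f₀ (g₊ 0)) ⟩
      + 0 ℤ.- d ℤ.* (ℤ.- c)   ≡⟨ negate d c ⟩
      d ℤ.* c                 ∎)
    (λ k → begin
      f (2 ℕ.+ k) ℤ.- f 0 ℤ.* g (2 ℕ.+ k)
        ≡⟨ cong₂ (λ y z → y ℤ.- f 0 ℤ.* z) (f₊ (suc k)) (g₊ (suc k)) ⟩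
      + 0 ℤ.- f 0 ℤ.* + 0
        ≡⟨ cong (λ z → + 0 ℤ.- z) (ℤ.*-zeroʳ (f 0)) ⟩
      + 0  ∎)
    g₊ n)
  (ℤ.*-assoc d c (c ℤ.^ n))
  where
  negate : ∀ d c → + 0 ℤ.- d ℤ.* (ℤ.- c) ≡ d ℤ.* c
  negate = solve-∀

x/[1-2x]-coeff₊ : ∀ n → (x /⟨ refl ⟩ (const (+ 1) - const (+ 2) * x)) (suc n) ≡ (+ 2) ℤ.^ n
x/[1-2x]-coeff₊ n = trans
  (quotient-geometric {+ 2} {+ 1} {g = const (+ 1) - const (+ 2) * x} refl (λ _ → refl) g₊ n)
  (ℤ.*-identityˡ _)
  where
  g₊ : ∀ n → (const (+ 1) - const (+ 2) * x) (suc n) ≡ const (ℤ.- (+ 2)) n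
  g₊ zero    = refl
  g₊ (suc n) = cong (λ z → + 0 ℤ.- z) (IsLinear.coeff₊ linear-2x (suc n))

2x²*-coeff : ∀ h n → (const (+ 2) * x ^ 2 * h) (2 ℕ.+ n) ≡ + 2 ℤ.* h n
2x²*-coeff h n = begin
  (2x² * h) (2 ℕ.+ n)           ≡⟨ *-shift 2x² h refl (suc n) ⟩
  ((2x² ∘ suc) * h) (suc n)     ≡⟨ *-shift (2x² ∘ suc) h refl n ⟩
  ((2x² ∘ (2 ℕ.+_)) * h) n      ≡⟨ *-congˡ-coeff h coeff n ⟩
  (const (+ 2) * h) n           ≡⟨ const-*-coeff (+ 2) h n ⟩
  + 2 ℤ.* h n                   ∎
  where
  2x² : Series
  2x² = const (+ 2) * x ^ 2

  coeff : 2x² ∘ (2 ℕ.+_) ≈ const (+ 2)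
  coeff k = begin
    2x² (2 ℕ.+ k)
      ≡⟨ const-*-coeff (+ 2) (x ^ 2) (2 ℕ.+ k) ⟩
    + 2 ℤ.* (x ^ 2) (2 ℕ.+ k)
      ≡⟨ cong (+ 2 ℤ.*_) (trans (linear-*-coeff₊ linear-x (x ^ 1) (suc k)) (ℤ.*-identityˡ _)) ⟩
    + 2 ℤ.* (x ^ 1) (suc k)
      ≡⟨ cong (+ 2 ℤ.*_) (trans (linear-*-coeff₊ linear-x (x ^ 0) k) (ℤ.*-identityˡ _)) ⟩
    + 2 ℤ.* const (+ 1) k
      ≡⟨ scale k ⟩
    const (+ 2) k  ∎
    where
    scale : ∀ k → + 2 ℤ.* const (+ 1) k ≡ const (+ 2) k
    scale zero    = refl
    scale (suc _) = refl

-- The recurrence for the subtrees at 0ᵐ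

eval-∷-at-1 : ∀ f fs n → eval (f ∷ fs) (const (+ 1)) n ≡ f n ℤ.+ eval fs (const (+ 1)) n
eval-∷-at-1 f fs n = cong (λ z → f n ℤ.+ z)
  (trans (const-*-coeff (+ 1) (eval fs (const (+ 1))) n) (ℤ.*-identityˡ _))

-- The sum over all j ≤ i + 1 splits into the terms with j ≥ 2, listed by
-- increasing l = i + 1 - j, and the terms with j = 1 and j = 0.
eval-at-1 : ∀ (G : ℕ → Series) (h : ℕ → ℕ) n → (∀ j → G j n ≡ + h j) → ∀ i →
  eval (applyUpTo (λ l → G (suc i ∸ l)) i) (const (+ 1)) n ℤ.+ (+ h 1 ℤ.+ + h 0) ≡
  + ℕ.sum (List.map h (downFrom (2 ℕ.+ i)))
eval-at-1 G h n Gh zero = begin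
  const (+ 0) n ℤ.+ (+ h 1 ℤ.+ + h 0)  ≡⟨ cong (ℤ._+ (+ h 1 ℤ.+ + h 0)) (zeros n) ⟩
  + 0 ℤ.+ (+ h 1 ℤ.+ + h 0)            ≡⟨ ℤ.+-identityˡ _ ⟩
  + (h 1 ℕ.+ h 0)                      ≡⟨ cong (λ z → + (h 1 ℕ.+ z)) (ℕ.+-identityʳ (h 0)) ⟨
  + (h 1 ℕ.+ (h 0 ℕ.+ 0))              ∎
  where
  zeros : ∀ n → const (+ 0) n ≡ + 0
  zeros zero    = refl
  zeros (suc _) = refl
eval-at-1 G h n Gh (suc i) = begin
  eval (G (2 ℕ.+ i) ∷ Gs) (const (+ 1)) n ℤ.+ rest
    ≡⟨ cong (ℤ._+ rest) (eval-∷-at-1 (G (2 ℕ.+ i)) Gs n) ⟩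
  G (2 ℕ.+ i) n ℤ.+ eval Gs (const (+ 1)) n ℤ.+ rest
    ≡⟨ ℤ.+-assoc (G (2 ℕ.+ i) n) _ rest ⟩
  G (2 ℕ.+ i) n ℤ.+ (eval Gs (const (+ 1)) n ℤ.+ rest)
    ≡⟨ cong₂ ℤ._+_ (Gh (2 ℕ.+ i)) (eval-at-1 G h n Gh i) ⟩
  + ℕ.sum (List.map h (downFrom (3 ℕ.+ i)))  ∎
  where
  Gs = applyUpTo (λ l → G (suc i ∸ l)) i
  rest = + h 1 ℤ.+ + h 0

sum-zeros : ∀ (js : List ℕ) → ℕ.sum (List.map (λ _ → 0) js) ≡ 0
sum-zeros []       = refl
sum-zeros (_ ∷ js) = sum-zeros js

private
  -- The number of nodes at distance ℓ below 0ᵐ, respectively below 0ᵐj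
  a : ℕ → ℕ → ℕ
  a m ℓ = card (subtree [ 𝟐𝟎𝟏 ] (Vec.replicate m 0) ℓ)

  b : ℕ → ℕ → ℕ → ℕ
  b m j ℓ = card (subtree [ 𝟐𝟎𝟏 ] (Vec.replicate m 0 ∷ʳ j) ℓ)

-- For m ≥ 1, the children 0ᵐ0 and 0ᵐ1 both count as 0ᵐ⁺¹.
b≡a : ∀ m {j} → j ≤ 1 → ∀ ℓ → b (suc m) j ℓ ≡ a (2 ℕ.+ m) ℓ
b≡a m j≤1 = card-binary
  (binary-∷ʳ (binary-zeros (suc m)) (ℕ.≤-trans j≤1 (s≤s z≤n)) j≤1) (binary-zeros (2 ℕ.+ m))

-- S i = Σ_{j=2}^{i+2} B_{i+2,j}(x), the coefficient of vⁱ in B(x,v,1)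
S : ℕ → Series
S i = eval (B⟨x,v,u⟩ [ 𝟐𝟎𝟏 ] i) (const (+ 1))

-- A_m = x + 2x A_{m+1} + x Σ_{j=2}^m B_{m,j} for m = i + 2
A-recurrence : ∀ i n → A[ [ 𝟐𝟎𝟏 ] ] (2 ℕ.+ i) (suc n) ≡
  const (+ 1) n ℤ.+ + 2 ℤ.* A[ [ 𝟐𝟎𝟏 ] ] (3 ℕ.+ i) n ℤ.+ S i n
A-recurrence i zero = begin
  + a (2 ℕ.+ i) 0         ≡⟨ cong +_ (card-root (binary-avoider (binary-zeros (2 ℕ.+ i)))) ⟩
  + 1                     ≡⟨ cong (λ z → + 1 ℤ.+ z) S₀ ⟨
  + 1 ℤ.+ S i 0           ∎
  where
  S₀ : S i 0 ≡ + 0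
  S₀ = begin
    S i 0                 ≡⟨ ℤ.+-identityʳ _ ⟨
    S i 0 ℤ.+ + 0         ≡⟨ eval-at-1 (B[ [ 𝟐𝟎𝟏 ] ] (2 ℕ.+ i)) (λ _ → 0) 0 (λ _ → refl) (suc i) ⟩
    + ℕ.sum (List.map (λ _ → 0) (downFrom (3 ℕ.+ i)))
                          ≡⟨ cong +_ (sum-zeros (downFrom (3 ℕ.+ i))) ⟩
    + 0                   ∎
A-recurrence i (suc ℓ) = begin
  + a (2 ℕ.+ i) (suc ℓ)
    ≡⟨ cong +_ (card-children [ 𝟐𝟎𝟏 ] (Vec.replicate (2 ℕ.+ i) 0) ℓ) ⟩
  + ℕ.sum (List.map (λ j → b (2 ℕ.+ i) j ℓ) (downFrom (3 ℕ.+ i)))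
    ≡⟨ eval-at-1 (B[ [ 𝟐𝟎𝟏 ] ] (2 ℕ.+ i)) (λ j → b (2 ℕ.+ i) j ℓ) (suc ℓ) (λ _ → refl) (suc i) ⟨
  S i (suc ℓ) ℤ.+ (+ b (2 ℕ.+ i) 1 ℓ ℤ.+ + b (2 ℕ.+ i) 0 ℓ)
    ≡⟨ cong₂ (λ y z → S i (suc ℓ) ℤ.+ (+ y ℤ.+ + z))
             (b≡a (suc i) (s≤s z≤n) ℓ) (b≡a (suc i) z≤n ℓ) ⟩
  S i (suc ℓ) ℤ.+ (+ a (3 ℕ.+ i) ℓ ℤ.+ + a (3 ℕ.+ i) ℓ)
    ≡⟨ rearrange (S i (suc ℓ)) (+ a (3 ℕ.+ i) ℓ) ⟩
  + 0 ℤ.+ + 2 ℤ.* + a (3 ℕ.+ i) ℓ ℤ.+ S i (suc ℓ)  ∎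
  where
  rearrange : ∀ s t → s ℤ.+ (t ℤ.+ t) ≡ + 0 ℤ.+ + 2 ℤ.* t ℤ.+ s
  rearrange = solve-∀

-- A_1 = x + 2x A_2, in degrees at least 2
A₁-coeff : ∀ n → A[ [ 𝟐𝟎𝟏 ] ] 1 (2 ℕ.+ n) ≡ + 2 ℤ.* A[ [ 𝟐𝟎𝟏 ] ] 2 (suc n)
A₁-coeff n = begin
  + a 1 (suc n)
    ≡⟨ cong +_ (card-children [ 𝟐𝟎𝟏 ] (Vec.replicate 1 0) n) ⟩
  + (b 1 1 n ℕ.+ (b 1 0 n ℕ.+ 0))
    ≡⟨ cong₂ (λ y z → + (y ℕ.+ (z ℕ.+ 0))) (b≡a 0 (s≤s z≤n) n) (b≡a 0 z≤n n) ⟩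
  + (2 ℕ.* a 2 n)
    ≡⟨ ℤ.pos-* 2 (a 2 n) ⟩
  + 2 ℤ.* + a 2 n  ∎

theorem3p4 : (Σxⁿ⁺¹ (∣I [ 𝟐𝟎𝟏 ] ∣) ≈ A⟨x,0⟩ [ 𝟐𝟎𝟏 ]) ×
    (A⟨x,0⟩ [ 𝟐𝟎𝟏 ] ≈
    (x /⟨ refl ⟩ (const (+ 1) - const (+ 2) * x)) + const (+ 2) * x ^ 2 * B⟨x,2x,1⟩ [ 𝟐𝟎𝟏 ])
theorem3p4 = counts , λ n → trans (substitute-0 (A⟨x,v⟩ [ 𝟐𝟎𝟏 ]) n) (formula n)
  where
  counts : Σxⁿ⁺¹ (∣I [ 𝟐𝟎𝟏 ] ∣) ≈ A⟨x,0⟩ [ 𝟐𝟎𝟏 ]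
  counts zero    = sym (substitute-0 (A⟨x,v⟩ [ 𝟐𝟎𝟏 ]) 0)
  counts (suc n) = trans (cong +_ (card-tree [ 𝟐𝟎𝟏 ] n))
                         (sym (substitute-0 (A⟨x,v⟩ [ 𝟐𝟎𝟏 ]) (suc n)))

  formula : A[ [ 𝟐𝟎𝟏 ] ] 1 ≈
    (x /⟨ refl ⟩ (const (+ 1) - const (+ 2) * x)) + const (+ 2) * x ^ 2 * B⟨x,2x,1⟩ [ 𝟐𝟎𝟏 ]
  formula 0 = refl
  formula 1 = cong +_ (card-root (binary-avoider (binary-zeros 1)))
  formula (suc (suc n)) = begin
    A[ [ 𝟐𝟎𝟏 ] ] 1 (2 ℕ.+ n)
      ≡⟨ A₁-coeff n ⟩
    + 2 ℤ.* A[ [ 𝟐𝟎𝟏 ] ] 2 (suc n)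
      ≡⟨ cong (+ 2 ℤ.*_) (unroll linear-2x (λ i → A[ [ 𝟐𝟎𝟏 ] ] (2 ℕ.+ i)) S
                                 (λ _ → refl) A-recurrence n) ⟩
    + 2 ℤ.* ((+ 2) ℤ.^ n ℤ.+ B⟨x,2x,1⟩ [ 𝟐𝟎𝟏 ] n)
      ≡⟨ ℤ.*-distribˡ-+ (+ 2) ((+ 2) ℤ.^ n) (B⟨x,2x,1⟩ [ 𝟐𝟎𝟏 ] n) ⟩
    (+ 2) ℤ.^ suc n ℤ.+ + 2 ℤ.* B⟨x,2x,1⟩ [ 𝟐𝟎𝟏 ] n
      ≡⟨ cong₂ ℤ._+_ (x/[1-2x]-coeff₊ (suc n)) (2x²*-coeff (B⟨x,2x,1⟩ [ 𝟐𝟎𝟏 ]) n) ⟨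
    (x /⟨ refl ⟩ (const (+ 1) - const (+ 2) * x)) (2 ℕ.+ n) ℤ.+
    (const (+ 2) * x ^ 2 * B⟨x,2x,1⟩ [ 𝟐𝟎𝟏 ]) (2 ℕ.+ n)  ∎
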